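{- For any bounded lattice $L$ and binary operation $\to$ on $L$, the following are equivalent: 1. $\to$ is a preconditional satisfying modus ponens ($a\wedge(a\to b)\leq b$ for all $a,b\in L$) and $(a\to 0)\to 0=a$ for all $a\in L$; 2. $L$ equipped with the unary operation $\neg$ defined by $\neg a:=a\to 0$ is an orthomodular lattice, and $\to$ coincides with the Sasaki hook, i.e., $a\to b=\neg a\vee(a\wedge b)$ for all $a,b\in L$.
   Context: A preconditional on a bounded lattice $L$ is a binary operation $\to$ on $L$ such that for all $a,b,c\in L$: (1) $1\to a\leq a$; (2) $a\wedge b\leq a\to b$; (3) $a\to b\leq a\to(a\wedge b)$; (4) $a\to(b\wedge c)\leq a\to b$; (5) $a\to((a\wedge b)\to c)\leq (a\wedge b)\to c$. An ortholattice is a bounded lattice equipped with a unary operation $\neg$ satisfying antitonicity ($a\leq b$ implies $\neg b\leq\neg a$), semicomplementation ($a\wedge\neg a=0$), and involution ($\neg\neg a=a$). An ortholattice is orthomodular if $a\leq b$ implies $b=a\vee(\neg a\wedge b)$. -}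

module Defs where

open import Algebra.Core using (Op₁; Op₂)
open import Level using (Level; _⊔_)
open import Relation.Binary.Definitions using (Antitonic₁)
open import Relation.Binary.Lattice.Bundles using (BoundedLattice)
import Algebra.Definitions as AlgebraicDefinitions

module _ {c ℓ₁ ℓ₂ : Level} (L : BoundedLattice c ℓ₁ ℓ₂) where
  open BoundedLattice L
  open AlgebraicDefinitions _≈_ using (Involutive)

  record IsPreconditional (_⇒_ : Op₂ Carrier) : Set (c ⊔ ℓ₂) where
    field
      ⊤⇒a≤a           : ∀ a → (⊤ ⇒ a) ≤ a
      a∧b≤a⇒b         : ∀ a b → (a ∧ b) ≤ (a ⇒ b)
      a⇒b≤a⇒a∧b       : ∀ a b → (a ⇒ b) ≤ (a ⇒ (a ∧ b))
      a⇒b∧c≤a⇒b       : ∀ a b c → (a ⇒ (b ∧ c)) ≤ (a ⇒ b)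
      a⇒[a∧b⇒c]≤a∧b⇒c : ∀ a b c → (a ⇒ ((a ∧ b) ⇒ c)) ≤ ((a ∧ b) ⇒ c)

  ModusPonens : Op₂ Carrier → Set (c ⊔ ℓ₂)
  ModusPonens _⇒_ = ∀ a b → (a ∧ (a ⇒ b)) ≤ b

  -- Congruence of ¬_ is not a field: it follows from antitonicity, since
  -- _≤_ is antisymmetric with respect to _≈_.
  record IsOrtholattice (¬_ : Op₁ Carrier) : Set (c ⊔ ℓ₁ ⊔ ℓ₂) where
    field
      antitone            : Antitonic₁ _≤_ _≤_ ¬_
      semicomplementation : ∀ a → (a ∧ (¬ a)) ≈ ⊥
      involutive          : Involutive ¬_

  record IsOrthomodularLattice (¬_ : Op₁ Carrier) : Set (c ⊔ ℓ₁ ⊔ ℓ₂) where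
    field
      isOrtholattice : IsOrtholattice ¬_
      orthomodular   : ∀ {a b} → a ≤ b → b ≈ (a ∨ ((¬ a) ∧ b))

    open IsOrtholattice isOrtholattice public

  negation : Op₂ Carrier → Op₁ Carrier
  negation _⇒_ a = a ⇒ ⊥

  sasakiHook : Op₁ Carrier → Op₂ Carrier
  sasakiHook ¬_ a b = (¬ a) ∨ (a ∧ b)

{-# OPTIONS --safe #-}
module Submission where

-- Axioms (3)-(5) make ⇒ monotone on the right and give b ⇒ (a ⇒ c) ≤ a ⇒ c
-- for a ≤ b.  With c = ⊥ this is antitonicity of ¬, and applied to
-- a ∧ ¬ (a ∧ b) ≤ a it gives a ⇒ b ≤ ¬ (a ∧ ¬ (a ∧ b)), which is the Sasaki
-- hook by De Morgan.  Modus ponens and the orthomodular law are exchanged by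
-- complementation, in both directions.

open import Defs
open import Algebra.Core using (Op₁; Op₂)
open import Algebra.Definitions using (Congruent₂)
open import Data.Product using (_×_; _,_)
open import Function.Bundles using (_⇔_; mk⇔)
open import Level using (Level)
open import Relation.Binary.Lattice.Bundles using (BoundedLattice)
import Relation.Binary.Lattice.Properties.JoinSemilattice as JoinProperties
import Relation.Binary.Lattice.Properties.MeetSemilattice as MeetProperties
import Relation.Binary.Reasoning.PartialOrder as PosetReasoning

module _ {c ℓ₁ ℓ₂ : Level} (L : BoundedLattice c ℓ₁ ℓ₂) where
  open BoundedLattice L
  open JoinProperties joinSemilattice using (∨-monotonic)
  open MeetProperties meetSemilattice using (∧-monotonic; y≤x⇒x∧y≈y)
  open PosetReasoning poset

  module OrtholatticeProperties {¬_ : Op₁ Carrier}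
                                (isOrtholattice : IsOrtholattice L ¬_) where
    open IsOrtholattice isOrtholattice

    ¬¬x≤x : ∀ x → (¬ (¬ x)) ≤ x
    ¬¬x≤x x = reflexive (involutive x)

    x≤¬¬x : ∀ x → x ≤ (¬ (¬ x))
    x≤¬¬x x = reflexive (Eq.sym (involutive x))

    ¬x≤y⇒¬y≤x : ∀ {x y} → (¬ x) ≤ y → (¬ y) ≤ x
    ¬x≤y⇒¬y≤x ¬x≤y = trans (antitone ¬x≤y) (¬¬x≤x _)

    x≤¬y⇒y≤¬x : ∀ {x y} → x ≤ (¬ y) → y ≤ (¬ x)
    x≤¬y⇒y≤¬x x≤¬y = trans (x≤¬¬x _) (antitone x≤¬y)

    ¬y≤¬x⇒x≤y : ∀ {x y} → (¬ y) ≤ (¬ x) → x ≤ y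
    ¬y≤¬x⇒x≤y ¬y≤¬x = trans (x≤¬y⇒y≤¬x ¬y≤¬x) (¬¬x≤x _)

    -- Involution allows contraposing: `¬ ((¬ x) ∨ (¬ y))` lies below both `x` and `y`, hence below
    -- their meet.
    ¬[x∧y]≤¬x∨¬y : ∀ x y → (¬ (x ∧ y)) ≤ ((¬ x) ∨ (¬ y))
    ¬[x∧y]≤¬x∨¬y x y = ¬x≤y⇒¬y≤x
      (∧-greatest (¬x≤y⇒¬y≤x (x≤x∨y _ _)) (¬x≤y⇒¬y≤x (y≤x∨y _ _)))

    ¬x∧¬y≤¬[x∨y] : ∀ x y → ((¬ x) ∧ (¬ y)) ≤ (¬ (x ∨ y))
    ¬x∧¬y≤¬[x∨y] x y = x≤¬y⇒y≤¬x
      (∨-least (x≤¬y⇒y≤¬x (x∧y≤x _ _)) (x≤¬y⇒y≤¬x (x∧y≤y _ _)))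

  module SasakiHookProperties {¬_ : Op₁ Carrier}
                              (isOrthomodular : IsOrthomodularLattice L ¬_) where
    open IsOrthomodularLattice isOrthomodular
    open OrtholatticeProperties isOrtholattice

    private
      _⇝_ : Op₂ Carrier
      _⇝_ = sasakiHook L ¬_

    isPreconditional : IsPreconditional L _⇝_
    isPreconditional = record
      { ⊤⇒a≤a = λ a → ∨-least
          (begin
            ¬ ⊤        ≤⟨ ∧-greatest (maximum _) refl ⟩
            ⊤ ∧ (¬ ⊤)  ≈⟨ semicomplementation ⊤ ⟩
            ⊥          ≤⟨ minimum a ⟩
            a          ∎)
          (x∧y≤y _ _)
      ; a∧b≤a⇒b = λ a b → y≤x∨y _ _
      ; a⇒b≤a⇒a∧b = λ a b →
          ∨-monotonic refl (∧-greatest (x∧y≤x _ _) refl)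
      ; a⇒b∧c≤a⇒b = λ a b c →
          ∨-monotonic refl (∧-monotonic refl (x∧y≤x _ _))
      -- Antitonicity puts `¬ a` below `¬ (a ∧ b)`, the first joinand of the target hook; the other
      -- joinand is a meet with that target.
      ; a⇒[a∧b⇒c]≤a∧b⇒c = λ a b c →
          ∨-least (trans (antitone (x∧y≤x _ _)) (x≤x∨y _ _)) (x∧y≤y _ _)
      }

    -- Complement of the orthomodular law for ¬ a ≤ ¬ (a ∧ b).
    modusPonens : ModusPonens L _⇝_
    modusPonens a b = trans (¬y≤¬x⇒x≤y (begin
      ¬ (a ∧ b)
        ≈⟨ orthomodular (antitone (x∧y≤x a b)) ⟩
      (¬ a) ∨ ((¬ (¬ a)) ∧ (¬ (a ∧ b)))
        -- By De Morgan the second joinand lies below `¬ (a ⇝ b)`, because `a ⇝ b` unfolds to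
        -- `(¬ a) ∨ (a ∧ b)`.
        ≤⟨ ∨-least (antitone (x∧y≤x _ _))
                   (trans (¬x∧¬y≤¬[x∨y] _ _) (antitone (x∧y≤y _ _))) ⟩
      ¬ (a ∧ (a ⇝ b))
        ∎)) (x∧y≤y a b)

  module PreconditionalProperties {_⇒_ : Op₂ Carrier}
                                  (⇒-cong : Congruent₂ _≈_ _⇒_)
                                  (isPreconditional : IsPreconditional L _⇒_) where
    open IsPreconditional isPreconditional

    -- Axiom (4) is monotonicity in disguise: `b ≤ c` makes `b` the meet `c ∧ b`, from which (4)
    -- keeps `c`.
    ⇒-monoʳ-≤ : ∀ a {b c} → b ≤ c → (a ⇒ b) ≤ (a ⇒ c)
    ⇒-monoʳ-≤ a {b} {c} b≤c = begin
      a ⇒ b        ≈⟨ ⇒-cong Eq.refl (y≤x⇒x∧y≈y b≤c) ⟨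
      a ⇒ (c ∧ b)  ≤⟨ a⇒b∧c≤a⇒b a c b ⟩
      a ⇒ c        ∎

    -- Axiom (5) with `a` in the role of `b ∧ a`. It stands in for antitonicity on the left, which
    -- the Sasaki hook lacks in general.
    a≤b⇒b⇒[a⇒c]≤a⇒c : ∀ {a b} c → a ≤ b → (b ⇒ (a ⇒ c)) ≤ (a ⇒ c)
    a≤b⇒b⇒[a⇒c]≤a⇒c {a} {b} c a≤b = begin
      b ⇒ (a ⇒ c)        ≈⟨ ⇒-cong Eq.refl (⇒-cong b∧a≈a Eq.refl) ⟨
      b ⇒ ((b ∧ a) ⇒ c)  ≤⟨ a⇒[a∧b⇒c]≤a∧b⇒c b a c ⟩
      (b ∧ a) ⇒ c        ≈⟨ ⇒-cong b∧a≈a Eq.refl ⟩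
      a ⇒ c              ∎
      where
      b∧a≈a : b ∧ a ≈ a
      b∧a≈a = y≤x⇒x∧y≈y a≤b

    module _ (modusPonens : ModusPonens L _⇒_)
             (involutive : ∀ a → ((a ⇒ ⊥) ⇒ ⊥) ≈ a) where
      private
        ¬_ : Op₁ Carrier
        ¬_ = negation L _⇒_

      negation-isOrtholattice : IsOrtholattice L (negation L _⇒_)
      negation-isOrtholattice = record
        -- `Antitonic₁` binds the larger element first. Raising `⊥` to `¬ a` turns `¬ b` into
        -- `b ⇒ (a ⇒ ⊥)`, which axiom (5) collapses to `¬ a`.
        { antitone            = λ {b} {a} a≤b →
            trans (⇒-monoʳ-≤ b (minimum _)) (a≤b⇒b⇒[a⇒c]≤a⇒c ⊥ a≤b)
        ; semicomplementation = λ a → antisym (modusPonens a ⊥) (minimum _)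
        ; involutive          = involutive
        }

      open IsOrtholattice negation-isOrtholattice using (antitone)
      open OrtholatticeProperties negation-isOrtholattice

      -- Complement of modus ponens for ¬ a and ¬ b.
      negation-orthomodular : ∀ {a b} → a ≤ b → b ≈ (a ∨ ((¬ a) ∧ b))
      negation-orthomodular {a} {b} a≤b = antisym
        (begin
          b                          ≤⟨ x≤¬y⇒y≤¬x (modusPonens (¬ a) (¬ b)) ⟩
          ¬ ((¬ a) ∧ h)              ≤⟨ ¬[x∧y]≤¬x∨¬y (¬ a) h ⟩
          (¬ (¬ a)) ∨ (¬ h)          ≤⟨ ∨-monotonic (¬¬x≤x a) (∧-greatest ¬h≤¬a ¬h≤b) ⟩
          a ∨ ((¬ a) ∧ b)            ∎)
        (∨-least a≤b (x∧y≤y _ _))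
        where
        h : Carrier
        h = (¬ a) ⇒ (¬ b)

        ¬h≤¬a : (¬ h) ≤ (¬ a)
        -- `¬ (¬ a)` is by definition `(¬ a) ⇒ ⊥`, so raising `⊥` to `¬ b` yields `a ≤ h`.
        ¬h≤¬a = antitone (trans (x≤¬¬x a) (⇒-monoʳ-≤ (¬ a) (minimum _)))

        ¬h≤b : (¬ h) ≤ b
        -- Here `a ≤ b` enters: `¬ b` lies below `(¬ a) ∧ (¬ b)`, hence below `h` by axiom (2).
        ¬h≤b = ¬x≤y⇒¬y≤x
          (trans (∧-greatest (antitone a≤b) refl) (a∧b≤a⇒b (¬ a) (¬ b)))

      negation-isOrthomodularLattice : IsOrthomodularLattice L (negation L _⇒_)
      negation-isOrthomodularLattice = record
        { isOrtholattice = negation-isOrtholattice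
        ; orthomodular   = negation-orthomodular
        }

      ⇒≈sasakiHook : ∀ a b → (a ⇒ b) ≈ sasakiHook L (negation L _⇒_) a b
      ⇒≈sasakiHook a b = antisym
        (begin
          a ⇒ b
            ≤⟨ a⇒b≤a⇒a∧b a b ⟩
          a ⇒ (a ∧ b)
            ≤⟨ ⇒-monoʳ-≤ a (x≤¬y⇒y≤¬x (x∧y≤y a (¬ (a ∧ b)))) ⟩
          a ⇒ (¬ (a ∧ (¬ (a ∧ b))))
            ≤⟨ a≤b⇒b⇒[a⇒c]≤a⇒c ⊥ (x∧y≤x _ _) ⟩
          ¬ (a ∧ (¬ (a ∧ b)))
            ≤⟨ ¬[x∧y]≤¬x∨¬y _ _ ⟩
          (¬ a) ∨ (¬ (¬ (a ∧ b)))
            ≤⟨ ∨-monotonic refl (¬¬x≤x _) ⟩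
          (¬ a) ∨ (a ∧ b)
            ∎)
        (∨-least (⇒-monoʳ-≤ a (minimum b)) (a∧b≤a⇒b a b))

  module _ {_⇒₁_ _⇒₂_ : Op₂ Carrier}
           (⇒₁≈⇒₂ : ∀ a b → (a ⇒₁ b) ≈ (a ⇒₂ b)) where

    modusPonens-resp-≈ : ModusPonens L _⇒₂_ → ModusPonens L _⇒₁_
    modusPonens-resp-≈ modusPonens a b =
      trans (∧-monotonic refl (reflexive (⇒₁≈⇒₂ a b))) (modusPonens a b)

    -- Carries the axioms from the Sasaki hook to an operation that agrees with it only up to `_≈_`.
    -- In axiom (5) the conditionals are nested, so the inner one is replaced by congruence.
    isPreconditional-resp-≈ : Congruent₂ _≈_ _⇒₁_ →
                              IsPreconditional L _⇒₂_ → IsPreconditional L _⇒₁_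
    isPreconditional-resp-≈ ⇒₁-cong isPreconditional = record
      { ⊤⇒a≤a           = λ a → trans (to ⊤ a) (⊤⇒a≤a a)
      ; a∧b≤a⇒b         = λ a b → trans (a∧b≤a⇒b a b) (from a b)
      ; a⇒b≤a⇒a∧b       = λ a b → trans (to a b) (trans (a⇒b≤a⇒a∧b a b) (from _ _))
      ; a⇒b∧c≤a⇒b       = λ a b c → trans (to _ _) (trans (a⇒b∧c≤a⇒b a b c) (from _ _))
      ; a⇒[a∧b⇒c]≤a∧b⇒c = λ a b c → begin
          a ⇒₁ ((a ∧ b) ⇒₁ c)  ≈⟨ ⇒₁-cong Eq.refl (⇒₁≈⇒₂ (a ∧ b) c) ⟩
          a ⇒₁ ((a ∧ b) ⇒₂ c)  ≈⟨ ⇒₁≈⇒₂ _ _ ⟩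
          a ⇒₂ ((a ∧ b) ⇒₂ c)  ≤⟨ a⇒[a∧b⇒c]≤a∧b⇒c a b c ⟩
          (a ∧ b) ⇒₂ c         ≈⟨ ⇒₁≈⇒₂ _ _ ⟨
          (a ∧ b) ⇒₁ c         ∎
      }
      where
      open IsPreconditional isPreconditional

      to : ∀ a b → (a ⇒₁ b) ≤ (a ⇒₂ b)
      to a b = reflexive (⇒₁≈⇒₂ a b)

      from : ∀ a b → (a ⇒₂ b) ≤ (a ⇒₁ b)
      from a b = reflexive (Eq.sym (⇒₁≈⇒₂ a b))

proposition5 : {c ℓ₁ ℓ₂ : Level} (L : BoundedLattice c ℓ₁ ℓ₂) →
    let open BoundedLattice L in
    (_⇒_ : Op₂ Carrier) → Congruent₂ _≈_ _⇒_ →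
    (IsPreconditional L _⇒_ × ModusPonens L _⇒_ × (∀ a → ((a ⇒ ⊥) ⇒ ⊥) ≈ a))
    ⇔
    (IsOrthomodularLattice L (negation L _⇒_) ×
    (∀ a b → (a ⇒ b) ≈ sasakiHook L (negation L _⇒_) a b))
proposition5 L _⇒_ ⇒-cong = mk⇔
  (λ (isPreconditional , modusPonens , involutive) →
    let open PreconditionalProperties L ⇒-cong isPreconditional in
    negation-isOrthomodularLattice modusPonens involutive ,
    ⇒≈sasakiHook modusPonens involutive)
  (λ (isOrthomodular , ⇒≈hook) →
    let open SasakiHookProperties L isOrthomodular in
    isPreconditional-resp-≈ L ⇒≈hook ⇒-cong isPreconditional ,
    modusPonens-resp-≈ L ⇒≈hook modusPonens ,
    IsOrthomodularLattice.involutive isOrthomodular)
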